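{- Let $I,J$ be disjoint finite sets, and let $T$ be a symmetrized tropical matrix with row index set $I^1\cup I^2$ and column index set $I\cup J$. Then $$\operatorname{tropical\ rank}(T)=\operatorname{tropical\ rank}(\Sigma(T))+|I|.$$
   Context: Supertropical structure: $\mathbb{S}=\mathbb{R}^{\tau}\cup\mathbb{R}^{\gamma}\cup\{\infty\}$ with tangible elements $a^\tau$ and ghost elements $a^\gamma$ ($a\in\mathbb{R}$); for $a>b$: $\infty\oplus s=s$, $\infty\odot s=\infty$, $b^j\oplus a^i=b^j$, $b^i\oplus b^j=b^\gamma$, $a^i\odot b^j=(a+b)^\alpha$ with $\alpha=\tau$ iff $i=j=\tau$. The permanent of an $m\times m$ supertropical matrix $A$ is $\bigoplus_{\sigma\in S_m}A(1|\sigma_1)\odot\cdots\odot A(m|\sigma_m)$; $A$ is tropically non-singular if its permanent is tangible, and the tropical rank of a supertropical matrix is the largest size of a tropically non-singular square submatrix. A tropical matrix (entries in $\overline{\mathbb{R}}=\mathbb{R}\cup\{\infty\}$) is regarded as supertropical by replacing each real $a$ by $a^\tau$. $I^1,I^2$ are two disjoint copies of $I$ (also disjoint from $I\cup J$), with $i^1,i^2$ the copies of $i\in I$. A tropical matrix $T$ with rows $I^1\cup I^2$ and columns $I\cup J$ is symmetrized if $T(i^1|i)=T(i^2|i)=0$ and $T(i^1|\hat\iota)=T(i^2|\hat\iota)=\infty$ for all $i\in I$, $\hat\iota\in I\setminus\{i\}$. Then $\Sigma(T)\in\mathbb{S}^{I\times J}$ is defined by $\Sigma(T)(i|j)=T(i^1|j)^\tau\oplus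 T(i^2|j)^\tau$ (with $\infty^\tau$ meaning $\infty$). -}

module Defs where

open import Level using (0ℓ)
open import Data.Nat using (ℕ; zero; suc; _≤_)
open import Data.Fin using (Fin)
open import Data.Fin.Properties using () renaming (_≟_ to _≟ᶠ_)
open import Data.Sum using (_⊎_; inj₁; inj₂)
open import Data.Product using (Σ; _×_; ∃-syntax)
open import Data.List using (List; []; _∷_; [_]; map; concatMap; foldr; filter; allFin)
open import Data.Vec as Vec using (Vec; lookup; toList)
open import Relation.Nullary using (¬_)
open import Relation.Binary using (Rel; Tri; tri<; tri≈; tri>)
open import Relation.Binary.PropositionalEquality using (_≡_)
open import Relation.Binary.Structures using (IsStrictTotalOrder)
open import Algebra.Structures using (IsCommutativeRing)
open import Function.Definitions using (Injective)
import Data.List.Relation.Unary.Unique.DecPropositional as UniqueDec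

-- The real numbers, axiomatised as a Dedekind-complete ordered field
-- (any model is isomorphic to ℝ).  The theorem is stated for every model.

record RealNumbers : Set₁ where
  infixl 6 _+_
  infixl 7 _*_
  infix 4 _<_
  field
    ℝ   : Set
    _+_ : ℝ → ℝ → ℝ
    _*_ : ℝ → ℝ → ℝ
    -_  : ℝ → ℝ
    0ℝ  : ℝ
    1ℝ  : ℝ
    _<_ : Rel ℝ 0ℓ
    isCommutativeRing : IsCommutativeRing _≡_ _+_ _*_ -_ 0ℝ 1ℝ
    0≢1 : ¬ (0ℝ ≡ 1ℝ)
    inverse : ∀ x → ¬ (x ≡ 0ℝ) → Σ ℝ (λ y → x * y ≡ 1ℝ)
    isStrictTotalOrder : IsStrictTotalOrder _≡_ _<_
    +-mono-< : ∀ {a b} c → a < b → a + c < b + c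
    *-pos    : ∀ {a b} → 0ℝ < a → 0ℝ < b → 0ℝ < a * b
    lub : (P : ℝ → Set) → Σ ℝ P → Σ ℝ (λ u → ∀ x → P x → ¬ (u < x)) →
          Σ ℝ (λ s → (∀ x → P x → ¬ (s < x)) ×
                     (∀ u → (∀ x → P x → ¬ (u < x)) → ¬ (u < s)))

module Tropical (RN : RealNumbers) where
  open RealNumbers RN
  open IsStrictTotalOrder isStrictTotalOrder using (compare)

  data ℝ̄ : Set where
    ∞   : ℝ̄
    fin : ℝ → ℝ̄

  -- tangible / ghost labels
  data Label : Set where
    τ γ : Label

  _∧ˡ_ : Label → Label → Label
  τ ∧ˡ τ = τ
  _ ∧ˡ _ = γ

  data 𝕊 : Set where
    ∞ˢ  : 𝕊
    elt : Label → ℝ → 𝕊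

  infixl 6 _⊕_
  infixl 7 _⊙_

  _⊕_ : 𝕊 → 𝕊 → 𝕊
  ∞ˢ ⊕ s = s
  elt i a ⊕ ∞ˢ = elt i a
  elt i a ⊕ elt j b with compare a b
  ... | tri< _ _ _ = elt i a
  ... | tri≈ _ _ _ = elt γ a
  ... | tri> _ _ _ = elt j b

  _⊙_ : 𝕊 → 𝕊 → 𝕊
  ∞ˢ ⊙ s = ∞ˢ
  elt i a ⊙ ∞ˢ = ∞ˢ
  elt i a ⊙ elt j b = elt (i ∧ˡ j) (a + b)

  _^τ : ℝ̄ → 𝕊
  ∞ ^τ = ∞ˢ
  fin a ^τ = elt τ a

  Tangible : 𝕊 → Set
  Tangible s = Σ ℝ (λ a → s ≡ elt τ a)

  allMaps : (k n : ℕ) → List (Vec (Fin n) k)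
  allMaps zero    n = [ Vec.[] ]
  allMaps (suc k) n = concatMap (λ v → map (λ x → x Vec.∷ v) (allFin n)) (allMaps k n)

  -- the symmetric group S_m: the injective (= bijective) maps Fin m → Fin m
  perms : (m : ℕ) → List (Vec (Fin m) m)
  perms m = filter (λ v → UniqueDec.unique? _≟ᶠ_ (toList v)) (allMaps m m)

  ⨁ : List 𝕊 → 𝕊
  ⨁ = foldr _⊕_ ∞ˢ

  ⨀ : List 𝕊 → 𝕊
  ⨀ = foldr _⊙_ (elt τ 0ℝ)

  per : (m : ℕ) → (Fin m → Fin m → 𝕊) → 𝕊
  per m A = ⨁ (map (λ σ → ⨀ (map (λ i → A i (lookup σ i)) (allFin m))) (perms m))

  TropNonSingular : (m : ℕ) → (Fin m → Fin m → 𝕊) → Set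
  TropNonSingular m A = Tangible (per m A)

  HasNonSingSub : {R C : Set} → (R → C → 𝕊) → ℕ → Set
  HasNonSingSub {R} {C} A k =
    Σ (Fin k → R) λ ρ → Σ (Fin k → C) λ κ →
      Injective _≡_ _≡_ ρ × Injective _≡_ _≡_ κ ×
      TropNonSingular k (λ a b → A (ρ a) (κ b))

  IsTropRank : {R C : Set} → (R → C → 𝕊) → ℕ → Set
  IsTropRank A r = HasNonSingSub A r × (∀ k → HasNonSingSub A k → k ≤ r)

  asSuper : {R C : Set} → (R → C → ℝ̄) → (R → C → 𝕊)
  asSuper T x y = T x y ^τ

  -- I = Fin p, J = Fin q (disjoint, via ⊎).
  -- Rows I¹ ∪ I² = Fin p ⊎ Fin p (inj₁ i = i¹, inj₂ i = i²);
  -- columns I ∪ J = Fin p ⊎ Fin q.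
  Symmetrized : (p q : ℕ) → (Fin p ⊎ Fin p → Fin p ⊎ Fin q → ℝ̄) → Set
  Symmetrized p q T =
    (∀ i → T (inj₁ i) (inj₁ i) ≡ fin 0ℝ × T (inj₂ i) (inj₁ i) ≡ fin 0ℝ) ×
    (∀ i i' → ¬ (i' ≡ i) → T (inj₁ i) (inj₁ i') ≡ ∞ × T (inj₂ i) (inj₁ i') ≡ ∞)

  Σᵀ : (p q : ℕ) → (Fin p ⊎ Fin p → Fin p ⊎ Fin q → ℝ̄) → (Fin p → Fin q → 𝕊)
  Σᵀ p q T i j = (T (inj₁ i) (inj₂ j) ^τ) ⊕ (T (inj₂ i) (inj₂ j) ^τ)

{-# OPTIONS --safe #-}

-- A square supertropical matrix is tropically non-singular exactly when, after
-- permuting its columns, there are real row and column potentials y, z such that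
-- each diagonal entry is the tangible element y a + z a and each other entry lies
-- strictly above y a + z b.  Such potentials certify that the identity is the
-- unique optimal permutation; conversely, unique optimality says that all cycles
-- of the exchange graph have positive weight, so that strict potentials exist.
--
-- Given potentials for a k × k submatrix of Σ(T), both copies of each chosen row i
-- are taken in T: the copy attaining the tangible minimum keeps its potential, the
-- other one is given a slightly larger one and is matched to column i; all the
-- remaining columns of I are matched to one copy of their row.  Conversely, a
-- non-singular submatrix of T of size k + p contains both copies of at least k rows
-- by the pigeonhole principle; keeping for each of them the copy with the smaller
-- potential yields potentials for a k × k submatrix of Σ(T).
module Submission where

open import Defs
open import Algebra.Bundles using (CommutativeMonoid; CommutativeRing)
open import Data.Empty using (⊥-elim)
open import Data.Fin using (Fin; zero; suc; punchIn; splitAt; join)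
open import Data.Fin.Permutation.Components using (transpose; transpose-inverse)
open import Data.Fin.Properties using (_≟_; any?; pigeonhole; punchIn-injective; punchInᵢ≢i; join-splitAt; ¬∀⟶∃¬) renaming (<-irrefl to <ᶠ-irrefl)
open import Data.List as List using (List; []; _∷_; [_]; _++_; map; foldr; concatMap; length; allFin; cartesianProductWith)
open import Data.List.Membership.Propositional using (_∈_; _∉_)
open import Data.List.Membership.Propositional.Properties using (∈-∃++; ∈-++⁺ˡ; ∈-++⁺ʳ; ∈-++⁻; ∈-map⁺; ∈-map⁻; ∈-allFin; ∈-concatMap⁺; ∈-concatMap⁻; ∈-cartesianProductWith⁺; ∈-cartesianProductWith⁻; ∈-filter⁺; ∈-filter⁻)
open import Data.List.Properties using (map-∘; map-cong; map-++; ∷-injective; ∷-injectiveˡ; length-map; length-++; ++-identityʳ)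
open import Data.List.Relation.Binary.Permutation.Propositional using (_↭_; ↭-refl; ↭-trans; prep; ↭⇒↭ₛ)
open import Data.List.Relation.Binary.Permutation.Propositional.Properties using (shift; ↭-length; map⁺)
import Data.List.Relation.Binary.Permutation.Setoid.Properties as Permₛ
open import Data.List.Relation.Unary.All as All using (All; []; _∷_)
open import Data.List.Relation.Unary.All.Properties using (¬Any⇒All¬; All¬⇒¬Any)
open import Data.List.Relation.Unary.AllPairs using ([]; _∷_)
open import Data.List.Relation.Unary.Any as Any using (here; there)
open import Data.List.Relation.Unary.Unique.Propositional using (Unique)
import Data.List.Relation.Unary.Unique.Propositional.Properties as Uniqueₚ
open import Data.Nat using (ℕ; zero; suc; _+_; _∸_; _≤_; s≤s)
import Data.Nat.Properties as ℕₚ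
open import Data.Product using (∃; ∃₂; _×_; _,_; proj₁; proj₂)
open import Data.Sum using (_⊎_; inj₁; inj₂; reduce)
open import Data.Vec as Vec using (Vec; []; _∷_; lookup; toList)
open import Data.Vec.Membership.Propositional.Properties using (∈-toList⁺; ∈-lookup)
open import Data.Vec.Properties using (lookup∘tabulate; tabulate∘lookup; tabulate-cong)
open import Data.Unit using (⊤; tt)
open import Function using (_∘_; id)
open import Function.Bundles using (_⇔_; mk⇔)
open import Function.Definitions using (Injective)
open import Relation.Binary.Definitions using (tri<; tri≈; tri>)
open import Relation.Binary.PropositionalEquality using (_≡_; _≢_; refl; sym; trans; cong; cong₂; subst; subst₂; setoid; module ≡-Reasoning)
open import Relation.Binary.Structures using (IsStrictTotalOrder)
open import Relation.Nullary using (¬_; yes; no)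
open import Relation.Nullary.Decidable using (dec-true; dec-false)

-- Repetition-free lists, permutations of finite sets and cycles.

unique-++⁻ : ∀ {A : Set} (xs : List A) {ys} → Unique (xs ++ ys) →
             Unique xs × Unique ys × (∀ {v} → v ∈ xs → v ∉ ys)
unique-++⁻ []       ys!        = [] , ys! , λ ()
unique-++⁻ (x ∷ xs) {ys} (x∉ ∷ u) with unique-++⁻ xs u
... | xs! , ys! , disj =
  All.tabulate (λ v∈ → All.lookup x∉ (∈-++⁺ˡ v∈)) ∷ xs! , ys! ,
  λ { (here refl) v∈ys → All.lookup x∉ (∈-++⁺ʳ xs v∈ys) refl
    ; (there v∈xs) v∈ys → disj v∈xs v∈ys }

unique-∷⁺ : ∀ {A : Set} {x : A} {xs} → x ∉ xs → Unique xs → Unique (x ∷ xs)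
unique-∷⁺ x∉ xs! = ¬Any⇒All¬ _ x∉ ∷ xs!

unique-⊆⇒↭ : ∀ {A : Set} {xs ys : List A} → Unique xs → (∀ {v} → v ∈ xs → v ∈ ys) →
             ∃ λ rest → ys ↭ xs ++ rest
unique-⊆⇒↭ {ys = ys} [] sub = ys , ↭-refl
unique-⊆⇒↭ {xs = x ∷ xs} (x∉ ∷ xs!) sub with ∈-∃++ (sub (here refl))
... | ys₁ , ys₂ , refl with unique-⊆⇒↭ {ys = ys₁ ++ ys₂} xs! sub′
  where
  sub′ : ∀ {v} → v ∈ xs → v ∈ ys₁ ++ ys₂
  sub′ v∈ with ∈-++⁻ ys₁ (sub (there v∈))
  ... | inj₁ v∈₁           = ∈-++⁺ˡ v∈₁
  ... | inj₂ (here refl)   = ⊥-elim (All.lookup x∉ v∈ refl)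
  ... | inj₂ (there v∈₂)   = ∈-++⁺ʳ ys₁ v∈₂
... | rest , eq = rest , ↭-trans (shift x ys₁ ys₂) (prep x eq)

injective⇒↭ : ∀ {n} {π : Fin n → Fin n} → Injective _≡_ _≡_ π → allFin n ↭ map π (allFin n)
injective⇒↭ {n} {π} inj
  with unique-⊆⇒↭ (Uniqueₚ.map⁺ inj (Uniqueₚ.allFin⁺ n)) (λ {v} _ → ∈-allFin v)
... | [] , eq = ↭-trans eq (subst (_↭ map π (allFin n)) (sym (++-identityʳ _)) ↭-refl)
-- A nonempty remainder would make `allFin n` longer than itself.
... | r ∷ rest , eq = ⊥-elim (ℕₚ.m≢1+m+n (length (allFin n)) (begin
  length (allFin n)                                      ≡⟨ ↭-length eq ⟩
  length (map π (allFin n) ++ r ∷ rest)                  ≡⟨ length-++ (map π (allFin n)) ⟩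
  length (map π (allFin n)) + suc (length rest)          ≡⟨ cong (_+ suc (length rest)) (length-map π (allFin n)) ⟩
  length (allFin n) + suc (length rest)                  ≡⟨ ℕₚ.+-suc _ _ ⟩
  suc (length (allFin n) + length rest)                  ∎))
  where open ≡-Reasoning

transpose-first : ∀ {n} (i j : Fin n) → transpose i j i ≡ j
transpose-first i j rewrite dec-true (i ≟ i) refl = refl

transpose-second : ∀ {n} (i j : Fin n) → transpose i j j ≡ i
transpose-second i j with j ≟ i
... | yes j≡i = j≡i
... | no _ rewrite dec-true (j ≟ j) refl = refl

transpose-other : ∀ {n} (i j : Fin n) {k} → k ≢ i → k ≢ j → transpose i j k ≡ k
transpose-other i j {k} k≢i k≢j
  rewrite dec-false (k ≟ i) k≢i | dec-false (k ≟ j) k≢j = refl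

map-fixed : ∀ {A : Set} {f : A → A} {xs} → (∀ {v} → v ∈ xs → f v ≡ v) → map f xs ≡ xs
map-fixed {xs = []}     fix = refl
map-fixed {xs = x ∷ xs} fix = cong₂ _∷_ (fix (here refl)) (map-fixed (fix ∘ there))

-- By induction, `σ` rotates `z ∷ l` and fixes `x`. Following it by the transposition of `x` and `z`
-- sends `x` to `z` and redirects the last entry from `z` to `x`.
cycle : ∀ {n} (x : Fin n) l → Unique (x ∷ l) →
        ∃ λ (σ : Fin n → Fin n) → Injective _≡_ _≡_ σ ×
          map σ (x ∷ l) ≡ l ++ [ x ] × (∀ v → v ∉ x ∷ l → σ v ≡ v)
cycle x [] _ = id , id , refl , λ _ _ → refl
cycle {n} x (z ∷ l) (x∉ ∷ u) with cycle z l u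
... | σ , inj , shifts , fixes = σ′ , inj′ , cong₂ _∷_ at-x at-rest , fixes′
  where
  x∉zl : x ∉ z ∷ l
  x∉zl = All¬⇒¬Any x∉
  σ′ : Fin n → Fin n
  σ′ = transpose x z ∘ σ
  inj′ : Injective _≡_ _≡_ σ′
  inj′ eq = inj (trans (sym (transpose-inverse z x))
                       (trans (cong (transpose z x) eq) (transpose-inverse z x)))
  at-x : σ′ x ≡ z
  at-x = trans (cong (transpose x z) (fixes x x∉zl)) (transpose-first x z)
  at-rest : map σ′ (z ∷ l) ≡ l ++ [ x ]
  at-rest = begin
    map σ′ (z ∷ l)                                 ≡⟨ map-∘ (z ∷ l) ⟩
    map (transpose x z) (map σ (z ∷ l))            ≡⟨ cong (map (transpose x z)) shifts ⟩
    map (transpose x z) (l ++ [ z ])               ≡⟨ map-++ (transpose x z) l [ z ] ⟩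
    map (transpose x z) l ++ [ transpose x z z ]   ≡⟨ cong₂ (λ xs v → xs ++ [ v ])
        (map-fixed λ v∈ → transpose-other x z (λ { refl → x∉zl (there v∈) })
                                              (λ { refl → Uniqueₚ.Unique[x∷xs]⇒x∉xs u v∈ }))
        (transpose-second x z) ⟩
    l ++ [ x ] ∎
    where open ≡-Reasoning
  fixes′ : ∀ v → v ∉ x ∷ z ∷ l → σ′ v ≡ v
  fixes′ v v∉ = trans (cong (transpose x z) (fixes v (v∉ ∘ there)))
    (transpose-other x z (λ { refl → v∉ (here refl) }) (λ { refl → v∉ (there (here refl)) }))

-- Arithmetic and order of the real field.

module Reals (RN : RealNumbers) where
  open RealNumbers RN renaming (_+_ to _+ᴿ_; _*_ to _*ᴿ_; _<_ to _<ᴿ_) public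
  open IsStrictTotalOrder isStrictTotalOrder using (compare)
    renaming (trans to <-trans; irrefl to <-irrefl) public

  ring : CommutativeRing _ _
  ring = record { isCommutativeRing = isCommutativeRing }

  open CommutativeRing ring using (+-commutativeMonoid; +-group; +-isCommutativeMonoid; -‿inverseʳ)
    renaming (+-comm to +ᴿ-comm; +-assoc to +ᴿ-assoc; +-identityˡ to +ᴿ-identityˡ;
              +-identityʳ to +ᴿ-identityʳ) public
  open import Algebra.Properties.Group +-group using (//-rightDividesˡ; //-rightDividesʳ) public
  open import Algebra.Properties.CommutativeSemigroup
    (CommutativeMonoid.commutativeSemigroup +-commutativeMonoid)
    using (interchange; xy∙z≈xz∙y) public

  +ᴿ-monoˡ-< : ∀ c {a b} → a <ᴿ b → c +ᴿ a <ᴿ c +ᴿ b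
  +ᴿ-monoˡ-< c {a} {b} a<b = subst₂ _<ᴿ_ (+ᴿ-comm a c) (+ᴿ-comm b c) (+-mono-< c a<b)

  +ᴿ-mono-< : ∀ {a b c d} → a <ᴿ b → c <ᴿ d → a +ᴿ c <ᴿ b +ᴿ d
  +ᴿ-mono-< {b = b} {c} a<b c<d = <-trans (+-mono-< c a<b) (+ᴿ-monoˡ-< b c<d)

  +ᴿ-cancelʳ-< : ∀ c {a b} → a +ᴿ c <ᴿ b +ᴿ c → a <ᴿ b
  +ᴿ-cancelʳ-< c {a} {b} lt =
    subst₂ _<ᴿ_ (//-rightDividesʳ c a) (//-rightDividesʳ c b) (+-mono-< (- c) lt)

  +ᴿ-cancelˡ-< : ∀ c {a b} → c +ᴿ a <ᴿ c +ᴿ b → a <ᴿ b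
  +ᴿ-cancelˡ-< c {a} {b} lt = +ᴿ-cancelʳ-< c (subst₂ _<ᴿ_ (+ᴿ-comm c a) (+ᴿ-comm c b) lt)

  +ᴿ-positive : ∀ {a b} → 0ℝ <ᴿ b → a <ᴿ a +ᴿ b
  +ᴿ-positive {a} {b} 0<b = subst (_<ᴿ a +ᴿ b) (+ᴿ-identityʳ a) (+ᴿ-monoˡ-< a 0<b)

  ≮-<-trans : ∀ {a b c} → ¬ (b <ᴿ a) → b <ᴿ c → a <ᴿ c
  ≮-<-trans {a} {b} b≮a b<c with compare a b
  ... | tri< a<b _ _ = <-trans a<b b<c
  ... | tri≈ _ refl _ = b<c
  ... | tri> _ _ b<a = ⊥-elim (b≮a b<a)

  <-≮-trans : ∀ {a b c} → a <ᴿ b → ¬ (c <ᴿ b) → a <ᴿ c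
  <-≮-trans {b = b} {c} a<b c≮b with compare b c
  ... | tri< b<c _ _ = <-trans a<b b<c
  ... | tri≈ _ refl _ = a<b
  ... | tri> _ _ c<b = ⊥-elim (c≮b c<b)

  double-<-0 : ∀ {h} → h <ᴿ 0ℝ → h +ᴿ h <ᴿ 0ℝ
  double-<-0 {h} h<0 = subst (h +ᴿ h <ᴿ_) (+ᴿ-identityʳ 0ℝ) (+ᴿ-mono-< h<0 h<0)

  2≢0 : 1ℝ +ᴿ 1ℝ ≢ 0ℝ
  2≢0 eq with compare 0ℝ 1ℝ
  ... | tri< 0<1 _ _ = <-irrefl (sym eq) (<-trans 0<1 (+ᴿ-positive 0<1))
  ... | tri≈ _ 0≡1 _ = 0≢1 0≡1
  ... | tri> _ _ 1<0 = <-irrefl eq (double-<-0 1<0)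

  halve : ∀ {d} → 0ℝ <ᴿ d → ∃ λ h → 0ℝ <ᴿ h × h +ᴿ h ≡ d
  halve {d} 0<d with inverse (1ℝ +ᴿ 1ℝ) 2≢0
  ... | i , 2i≡1 = h , h-positive , h+h≡d
    where
    open CommutativeRing ring using (*-assoc; *-comm; *-identityˡ; distribʳ)
    h : ℝ
    h = i *ᴿ d
    h+h≡d : h +ᴿ h ≡ d
    h+h≡d = begin
      h +ᴿ h                   ≡⟨ cong₂ _+ᴿ_ (*-identityˡ h) (*-identityˡ h) ⟨
      1ℝ *ᴿ h +ᴿ 1ℝ *ᴿ h       ≡⟨ distribʳ h 1ℝ 1ℝ ⟨
      (1ℝ +ᴿ 1ℝ) *ᴿ (i *ᴿ d)   ≡⟨ *-assoc (1ℝ +ᴿ 1ℝ) i d ⟨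
      (1ℝ +ᴿ 1ℝ) *ᴿ i *ᴿ d     ≡⟨ cong (_*ᴿ d) 2i≡1 ⟩
      1ℝ *ᴿ d                  ≡⟨ *-identityˡ d ⟩
      d                        ∎
      where open ≡-Reasoning
    h-positive : 0ℝ <ᴿ h
    h-positive with compare 0ℝ h
    ... | tri< 0<h _ _ = 0<h
    ... | tri≈ _ 0≡h _ = ⊥-elim (<-irrefl (trans (sym (+ᴿ-identityʳ 0ℝ)) (trans (cong₂ _+ᴿ_ 0≡h 0≡h) h+h≡d)) 0<d)
    ... | tri> _ _ h<0 = ⊥-elim (<-irrefl refl (<-trans 0<d (subst (_<ᴿ 0ℝ) h+h≡d (double-<-0 h<0))))

  <⇒0<- : ∀ {a b} → a <ᴿ b → 0ℝ <ᴿ b +ᴿ - a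
  <⇒0<- {a} {b} a<b = subst (_<ᴿ b +ᴿ - a) (-‿inverseʳ a) (+-mono-< (- a) a<b)

  dense : ∀ {a b} → a <ᴿ b → ∃ λ m → a <ᴿ m × m <ᴿ b
  dense {a} {b} a<b with halve (<⇒0<- a<b)
  ... | h , 0<h , h+h≡ = a +ᴿ h , +ᴿ-positive 0<h , subst (a +ᴿ h <ᴿ_) a+h+h≡b (+ᴿ-positive 0<h)
    where
    a+h+h≡b : a +ᴿ h +ᴿ h ≡ b
    a+h+h≡b = trans (+ᴿ-assoc a h h) (trans (cong (a +ᴿ_) h+h≡) (trans (+ᴿ-comm a _) (//-rightDividesˡ a b)))

  no-max : ∀ a → ∃ λ m → a <ᴿ m
  -- The sign of 1 is not among the axioms; the increment is 1 or -1, whichever is positive.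
  no-max a with compare 0ℝ 1ℝ
  ... | tri< 0<1 _ _ = a +ᴿ 1ℝ , +ᴿ-positive 0<1
  ... | tri≈ _ 0≡1 _ = ⊥-elim (0≢1 0≡1)
  ... | tri> _ _ 1<0 = a +ᴿ - 1ℝ , +ᴿ-positive (subst (0ℝ <ᴿ_) (+ᴿ-identityˡ _) (<⇒0<- 1<0))

  no-min : ∀ a → ∃ λ m → m <ᴿ a
  no-min a with no-max 0ℝ
  ... | m , 0<m = a +ᴿ - m , +ᴿ-cancelʳ-< m (subst (_<ᴿ a +ᴿ m) (sym (//-rightDividesˡ m a)) (+ᴿ-positive 0<m))

  -- Finite systems of strict bounds on one real number.

  infix 4 _<ˡ_
  _<ˡ_ : ℝ → List ℝ → Set
  m <ˡ us = ∀ {u} → u ∈ us → m <ᴿ u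

  below : ∀ us → ∃ (_<ˡ us)
  below [] = 0ℝ , λ ()
  below (u ∷ us) with below us
  ... | m , m< with compare m u
  ...   | tri< m<u _ _ = m , λ { (here refl) → m<u ; (there v∈) → m< v∈ }
  ...   | tri≈ _ refl _ with no-min m
  ...     | m′ , m′<m = m′ , λ { (here refl) → m′<m ; (there v∈) → <-trans m′<m (m< v∈) }
  below (u ∷ us) | m , m< | tri> _ _ u<m with no-min u
  ...     | m′ , m′<u = m′ , λ { (here refl) → m′<u ; (there v∈) → <-trans (<-trans m′<u u<m) (m< v∈) }

  raise : ∀ {l} us → l <ˡ us → ∃ λ m → l <ᴿ m × m <ˡ us
  raise {l} [] _ with no-max l
  ... | m , l<m = m , l<m , λ ()
  raise (u ∷ us) l< with raise us (l< ∘ there)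
  ... | m , l<m , m< with compare m u
  ...   | tri< m<u _ _ = m , l<m , λ { (here refl) → m<u ; (there v∈) → m< v∈ }
  ...   | tri≈ _ refl _ with dense l<m
  ...     | m′ , l<m′ , m′<m = m′ , l<m′ , λ { (here refl) → m′<m ; (there v∈) → <-trans m′<m (m< v∈) }
  raise (u ∷ us) l< | m , l<m , m< | tri> _ _ u<m with dense (l< (here refl))
  ...     | m′ , l<m′ , m′<u = m′ , l<m′ , λ { (here refl) → m′<u ; (there v∈) → <-trans (<-trans m′<u u<m) (m< v∈) }

  -- Start from a number under all upper bounds and push it past the lower bounds one at a time.
  -- Density gives room for each push, and the absence of extreme elements covers the case of an
  -- empty list.
  between : ∀ ls us → (∀ {l} → l ∈ ls → l <ˡ us) →
            ∃ λ m → (∀ {l} → l ∈ ls → l <ᴿ m) × m <ˡ us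
  between [] us _ with below us
  ... | m , m< = m , (λ ()) , m<
  between (l ∷ ls) us ls<us with between ls us (ls<us ∘ there)
  ... | m , <m , m< with compare l m
  ...   | tri< l<m _ _ = m , (λ { (here refl) → l<m ; (there v∈) → <m v∈ }) , m<
  ...   | tri≈ _ refl _ with raise us m<
  ...     | m′ , m<m′ , m′< = m′ , (λ { (here refl) → m<m′ ; (there v∈) → <-trans (<m v∈) m<m′ }) , m′<
  between (l ∷ ls) us ls<us | m , <m , m< | tri> _ _ m<l with raise us (ls<us (here refl))
  ...     | m′ , l<m′ , m′< = m′ , (λ { (here refl) → l<m′ ; (there v∈) → <-trans (<-trans (<m v∈) m<l) l<m′ }) , m′<

  gather : ∀ {n} → (Fin n → List ℝ) → List ℝ
  gather {n} f = concatMap f (allFin n)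

  ∈-gather⁺ : ∀ {n} (f : Fin n → List ℝ) i {r} → r ∈ f i → r ∈ gather f
  ∈-gather⁺ f i r∈ = ∈-concatMap⁺ f (Any.map (λ { refl → r∈ }) (∈-allFin i))

  ∈-gather⁻ : ∀ {n} (f : Fin n → List ℝ) {r} → r ∈ gather f → ∃ λ i → r ∈ f i
  ∈-gather⁻ {n} f r∈ = Any.satisfied (∈-concatMap⁻ f {xs = allFin n} r∈)

  -- Finite sums and their invariance under permutations.

  ∑ : ∀ {A : Set} → (A → ℝ) → List A → ℝ
  ∑ v xs = foldr _+ᴿ_ 0ℝ (map v xs)

  ∑-↭ : ∀ {A : Set} (v : A → ℝ) {xs ys} → xs ↭ ys → ∑ v xs ≡ ∑ v ys
  ∑-↭ v p = Permₛ.foldr-commMonoid (setoid ℝ) +-isCommutativeMonoid (↭⇒↭ₛ (map⁺ v p))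

  ∑-+ : ∀ {A : Set} (v w : A → ℝ) xs → ∑ (λ x → v x +ᴿ w x) xs ≡ ∑ v xs +ᴿ ∑ w xs
  ∑-+ v w []       = sym (+ᴿ-identityʳ 0ℝ)
  ∑-+ v w (x ∷ xs) = trans (cong (v x +ᴿ w x +ᴿ_) (∑-+ v w xs)) (interchange _ _ _ _)

  ∑-++-zero : ∀ {A : Set} (v : A → ℝ) xs {ys} → (∀ {x} → x ∈ ys → v x ≡ 0ℝ) → ∑ v (xs ++ ys) ≡ ∑ v xs
  ∑-++-zero v [] {[]}     zeros = refl
  ∑-++-zero v [] {y ∷ ys} zeros =
    trans (cong₂ _+ᴿ_ (zeros (here refl)) (∑-++-zero v [] (zeros ∘ there))) (+ᴿ-identityʳ 0ℝ)
  ∑-++-zero v (x ∷ xs)    zeros = cong (v x +ᴿ_) (∑-++-zero v xs zeros)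

  ∑-injective : ∀ {n} (v : Fin n → ℝ) {π} → Injective _≡_ _≡_ π → ∑ (v ∘ π) (allFin n) ≡ ∑ v (allFin n)
  ∑-injective {n} v {π} inj = begin
    ∑ (v ∘ π) (allFin n)       ≡⟨ cong (foldr _+ᴿ_ 0ℝ) (map-∘ (allFin n)) ⟩
    ∑ v (map π (allFin n))     ≡⟨ ∑-↭ v (injective⇒↭ inj) ⟨
    ∑ v (allFin n)             ∎
    where open ≡-Reasoning

  ∑-support : ∀ {n} (v : Fin n → ℝ) {xs} → Unique xs → (∀ x → x ∉ xs → v x ≡ 0ℝ) →
              ∑ v (allFin n) ≡ ∑ v xs
  ∑-support {n} v {xs} xs! zeros with unique-⊆⇒↭ xs! (λ {x} _ → ∈-allFin x)
  ... | rest , p = trans (∑-↭ v p) (∑-++-zero v xs λ {x} x∈ → zeros x λ x∈xs → disj x∈xs x∈)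
    where
    disj : ∀ {x} → x ∈ xs → x ∉ rest
    disj = proj₂ (proj₂ (unique-++⁻ xs
      (Permₛ.Unique-resp-↭ (setoid (Fin n)) (↭⇒↭ₛ p) (Uniqueₚ.allFin⁺ n))))

  -- Weighted walks, loop erasure and positive cycles.

  data Walk {V : Set} (E : V → V → List ℝ) : V → List V → V → ℝ → Set where
    edge : ∀ {x y r} → r ∈ E x y → Walk E x [] y r
    _◂_  : ∀ {x y z l r s} → r ∈ E x z → Walk E z l y s → Walk E x (z ∷ l) y (r +ᴿ s)

  module _ {V : Set} {E : V → V → List ℝ} where

    split : ∀ {x y z r} l₁ {l₂} → Walk E x (l₁ ++ z ∷ l₂) y r →
            ∃₂ λ r₁ r₂ → Walk E x l₁ z r₁ × Walk E z l₂ y r₂ × r ≡ r₁ +ᴿ r₂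
    split []       (e ◂ w) = _ , _ , edge e , w , refl
    split (_ ∷ l₁) (_◂_ {r = r} e w) with split l₁ w
    ... | r₁ , r₂ , w₁ , w₂ , refl = r +ᴿ r₁ , r₂ , e ◂ w₁ , w₂ , sym (+ᴿ-assoc r r₁ r₂)

  SimpleCyclesPositive CyclesPositive : ∀ {V : Set} → (V → V → List ℝ) → Set
  SimpleCyclesPositive E = ∀ {x l r} → Unique (x ∷ l) → Walk E x l x r → 0ℝ <ᴿ r
  CyclesPositive E = ∀ {x l r} → Walk E x l x r → 0ℝ <ᴿ r

  module _ {n} {E : Fin n → Fin n → List ℝ} (pos : SimpleCyclesPositive E) where
    open import Data.List.Membership.DecPropositional (_≟_ {n}) using (_∈?_)

    -- The walk returns to its start `x`. Its part up to that return is a simple cycle, so dropping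
    -- it lowers the weight.
    shortcut : ∀ {x l y r} → x ∈ l → Walk E x l y r → Unique l → y ∉ l →
               ∃₂ λ l′ r′ → Walk E x l′ y r′ × Unique (x ∷ l′) × y ∉ l′ × r′ <ᴿ r
    shortcut {x} x∈l w l! y∉l with ∈-∃++ x∈l
    ... | l₁ , l₂ , refl with split l₁ w | unique-++⁻ l₁ l!
    ...   | r₁ , r₂ , w₁ , w₂ , refl | l₁! , xl₂! , disj =
      l₂ , r₂ , w₂ , xl₂! , (λ y∈ → y∉l (∈-++⁺ʳ l₁ (there y∈))) ,
      subst (r₂ <ᴿ_) (+ᴿ-comm r₂ r₁)
        (+ᴿ-positive (pos (unique-∷⁺ (λ x∈l₁ → disj x∈l₁ (here refl)) l₁!) w₁))

    -- Every erased loop is a simple cycle, hence of positive weight, so erasing never increases the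
    -- total. The endpoints may coincide, and then what remains is a simple cycle.
    erase-loops : ∀ {x l y r} → Walk E x l y r →
                  ∃₂ λ l′ r′ → Walk E x l′ y r′ × Unique (x ∷ l′) × y ∉ l′ × ¬ (r <ᴿ r′)
    erase-loops {r = r} (edge e) = [] , r , edge e , [] ∷ [] , (λ ()) , <-irrefl refl
    erase-loops {x} {y = y} (_◂_ {z = z} {r = r} {s} e w) with erase-loops w
    ... | l′ , s′ , w′ , u , y∉l′ , s≮s′ with z ≟ y
    -- The tail is itself a simple cycle at `y`; the first edge alone already reaches `y` at a
    -- smaller weight.
    ...   | yes refl = [] , r , edge e , [] ∷ [] , (λ ()) ,
              λ lt → <-irrefl refl (<-trans lt (+ᴿ-positive (<-≮-trans (pos u w′) s≮s′)))
    ...   | no z≢y with x ∈? (z ∷ l′)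
    ...     | no x∉ = z ∷ l′ , r +ᴿ s′ , e ◂ w′ , unique-∷⁺ x∉ u ,
                (λ { (here y≡z) → z≢y (sym y≡z) ; (there y∈) → y∉l′ y∈ }) ,
                s≮s′ ∘ +ᴿ-cancelˡ-< r
    ...     | yes x∈ with shortcut x∈ (e ◂ w′) u
                            (λ { (here y≡z) → z≢y (sym y≡z) ; (there y∈) → y∉l′ y∈ })
    ...       | l″ , r″ , w″ , u″ , y∉l″ , r″<r+s′ =
                l″ , r″ , w″ , u″ , y∉l″ , λ lt → s≮s′ (+ᴿ-cancelˡ-< r (<-trans lt r″<r+s′))

  cyclesPositive : ∀ {n} {E : Fin n → Fin n → List ℝ} → SimpleCyclesPositive E → CyclesPositive E
  cyclesPositive pos w with erase-loops pos w
  ... | _ , _ , w′ , u , _ , r≮r′ = <-≮-trans (pos u w′) r≮r′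

  -- Bypassing a vertex creates parallel edges, which is why an ordered pair of vertices carries a
  -- list of weights rather than at most one.
  eliminate : ∀ {n} → (Fin (suc n) → Fin (suc n) → List ℝ) → Fin n → Fin n → List ℝ
  eliminate E x y = E (suc x) (suc y) ++ cartesianProductWith _+ᴿ_ (E (suc x) zero) (E zero (suc y))

  module _ {n} {E : Fin (suc n) → Fin (suc n) → List ℝ} where

    -- Expanding the detours preserves the weight, so positivity of closed walks passes to the
    -- smaller graph. The expanded walk may meet `zero` repeatedly, hence the induction needs all
    -- closed walks and not only the simple ones.
    eliminate-walk : ∀ {x l y r} → Walk (eliminate E) x l y r → ∃ λ l′ → Walk E (suc x) l′ (suc y) r
    eliminate-walk {x} (edge e) with ∈-++⁻ (E (suc x) _) e
    ... | inj₁ direct = _ , edge direct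
    ... | inj₂ detour with ∈-cartesianProductWith⁻ _+ᴿ_ (E (suc x) zero) _ detour
    ...   | _ , _ , e₁ , e₂ , refl = _ , e₁ ◂ edge e₂
    eliminate-walk {x} (_◂_ {z = z} {s = s} e w) with ∈-++⁻ (E (suc x) (suc z)) e | eliminate-walk w
    ... | inj₁ direct | _ , w′ = _ , direct ◂ w′
    ... | inj₂ detour | _ , w′ with ∈-cartesianProductWith⁻ _+ᴿ_ (E (suc x) zero) _ detour
    ...   | r₁ , r₂ , e₁ , e₂ , refl = _ , subst (Walk E _ _ _) (sym (+ᴿ-assoc r₁ r₂ s)) (e₁ ◂ (e₂ ◂ w′))

  IsPotential : ∀ {V : Set} → (V → V → List ℝ) → (V → ℝ) → Set
  IsPotential E u = ∀ {x y r} → r ∈ E x y → u y <ᴿ r +ᴿ u x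

  -- Fourier–Motzkin elimination of the variable u zero: the constraints on the
  -- remaining variables are exactly those of the graph with vertex zero bypassed.
  potential : ∀ {n} (E : Fin n → Fin n → List ℝ) → CyclesPositive E → ∃ (IsPotential E)
  potential {zero}  E pos = (λ ()) , λ { {()} }
  potential {suc n} E pos with potential (eliminate E) (λ w → pos (proj₂ (eliminate-walk w)))
  ... | u , u-ok with between (gather lowers) (gather uppers) lowers<uppers
    where
    lowers uppers : Fin n → List ℝ
    lowers j = map (λ r → u j +ᴿ - r) (E zero (suc j))
    uppers i = map (_+ᴿ u i) (E (suc i) zero)
    lowers<uppers : ∀ {l} → l ∈ gather lowers → l <ˡ gather uppers
    lowers<uppers l∈ u∈ with ∈-gather⁻ lowers l∈ | ∈-gather⁻ uppers u∈
    ... | j , l∈j | i , u∈i with ∈-map⁻ _ l∈j | ∈-map⁻ _ u∈i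
    -- The lower bound stems from an edge of weight `r` from `zero` to `j`, the upper bound from an
    -- edge of weight `s` from `i` to `zero`. Their comparison is the constraint of the bypass from
    -- `i` to `j`, of weight `s + r`.
    ...   | r , r∈ , refl | s , s∈ , refl = +ᴿ-cancelʳ-< r (subst₂ _<ᴿ_
      (sym (//-rightDividesˡ r (u j))) (xy∙z≈xz∙y s r (u i))
      (u-ok (∈-++⁺ʳ (E (suc i) (suc j)) (∈-cartesianProductWith⁺ _+ᴿ_ s∈ r∈))))
  ... | m , <m , m< = u′ , u′-ok
    where
    u′ : Fin (suc n) → ℝ
    u′ zero    = m
    u′ (suc i) = u i
    u′-ok : IsPotential E u′
    -- A loop at `zero` is a closed walk with one edge, so its weight is positive.
    u′-ok {zero} {zero} {r} r∈ = subst (m <ᴿ_) (+ᴿ-comm m r) (+ᴿ-positive (pos (edge r∈)))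
    u′-ok {zero} {suc j} {r} r∈ = subst₂ _<ᴿ_ (//-rightDividesˡ r (u j)) (+ᴿ-comm m r)
      (+-mono-< r (<m (∈-gather⁺ _ j (∈-map⁺ _ r∈))))
    u′-ok {suc i} {zero} r∈ = m< (∈-gather⁺ _ i (∈-map⁺ _ r∈))
    u′-ok {suc i} {suc j} r∈ = u-ok (∈-++⁺ˡ r∈)

-- Enumeration of the symmetric group.

module Supertropical (RN : RealNumbers) where
  open Reals RN
  open Tropical RN

  concatMap-map : ∀ {A B C : Set} (f : A → B → C) xs ys →
                  concatMap (λ x → map (f x) ys) xs ≡ cartesianProductWith f xs ys
  concatMap-map f []       ys = refl
  concatMap-map f (x ∷ xs) ys = cong (map (f x) ys ++_) (concatMap-map f xs ys)

  ∈-allMaps : ∀ {k n} (v : Vec (Fin n) k) → v ∈ allMaps k n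
  ∈-allMaps []                       = here refl
  ∈-allMaps {suc k} {n} (x ∷ v) = subst (x ∷ v ∈_) (sym (concatMap-map (λ v x → x ∷ v) (allMaps k n) (allFin n)))
    (∈-cartesianProductWith⁺ (λ v x → x ∷ v) (∈-allMaps v) (∈-allFin x))

  allMaps-unique : ∀ k n → Unique (allMaps k n)
  allMaps-unique zero    n = [] ∷ []
  allMaps-unique (suc k) n = subst Unique (sym (concatMap-map (λ v x → x ∷ v) (allMaps k n) (allFin n)))
    (Uniqueₚ.cartesianProductWith⁺ (λ v x → x ∷ v) (λ { refl → refl , refl })
      (allMaps-unique k n) (Uniqueₚ.allFin⁺ n))

  perms-unique : ∀ m → Unique (perms m)
  perms-unique m = Uniqueₚ.filter⁺ _ (allMaps-unique m m)

  toList-tabulate : ∀ {A : Set} {n} (f : Fin n → A) → toList (Vec.tabulate f) ≡ List.tabulate f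
  toList-tabulate {n = zero}  f = refl
  toList-tabulate {n = suc n} f = cong (f zero ∷_) (toList-tabulate (f ∘ suc))

  ∈-perms⁺ : ∀ {m} {π : Fin m → Fin m} → Injective _≡_ _≡_ π → Vec.tabulate π ∈ perms m
  ∈-perms⁺ {π = π} inj = ∈-filter⁺ _ (∈-allMaps (Vec.tabulate π))
    (subst Unique (sym (toList-tabulate π)) (Uniqueₚ.tabulate⁺ inj))

  lookup-injective : ∀ {A : Set} {n} (v : Vec A n) → Unique (toList v) → Injective _≡_ _≡_ (lookup v)
  lookup-injective (x ∷ v) u {zero}  {zero}  eq = refl
  lookup-injective (x ∷ v) u {zero}  {suc j} refl = ⊥-elim (Uniqueₚ.Unique[x∷xs]⇒x∉xs u (∈-toList⁺ (∈-lookup j v)))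
  lookup-injective (x ∷ v) u {suc i} {zero}  refl = ⊥-elim (Uniqueₚ.Unique[x∷xs]⇒x∉xs u (∈-toList⁺ (∈-lookup i v)))
  lookup-injective (x ∷ v) (_ ∷ u) {suc i} {suc j} eq = cong suc (lookup-injective v u eq)

  perms-injective : ∀ {m σ} → σ ∈ perms m → Injective _≡_ _≡_ (lookup σ)
  perms-injective {m} {σ} σ∈ = lookup-injective σ (proj₂ (∈-filter⁻ _ {xs = allMaps m m} σ∈))

  -- Lower bounds and tangibility of supertropical sums and products.

  elt-injective : ∀ {i j a b} → elt i a ≡ elt j b → a ≡ b
  elt-injective refl = refl

  -- Labels are ignored: a term strictly above the minimum is absorbed in a sum, whether it is
  -- tangible or ghost.
  Above : ℝ → 𝕊 → Set
  Above a ∞ˢ        = ⊤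
  Above a (elt _ b) = a <ᴿ b

  Above-≮ : ∀ {a b} s → ¬ (b <ᴿ a) → Above b s → Above a s
  Above-≮ ∞ˢ        b≮a _   = tt
  Above-≮ (elt _ _) b≮a b<c = ≮-<-trans b≮a b<c

  ⊕-above⁺ : ∀ {a} s t → Above a s → Above a t → Above a (s ⊕ t)
  ⊕-above⁺ ∞ˢ        t         _ q = q
  ⊕-above⁺ (elt _ _) ∞ˢ        p _ = p
  ⊕-above⁺ (elt _ b) (elt _ c) p q with compare b c
  ... | tri< _ _ _ = p
  ... | tri≈ _ _ _ = p
  ... | tri> _ _ _ = q

  ⊕-above⁻ : ∀ {a} s t → Above a (s ⊕ t) → Above a s × Above a t
  ⊕-above⁻ ∞ˢ        t         q = tt , q
  ⊕-above⁻ (elt _ _) ∞ˢ        p = p , tt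
  ⊕-above⁻ (elt _ b) (elt _ c) p with compare b c
  ... | tri< b<c _ _ = p , <-trans p b<c
  ... | tri≈ _ refl _ = p , p
  ... | tri> _ _ c<b = <-trans p c<b , p

  ⊕-tangibleˡ : ∀ {a} t → Above a t → elt τ a ⊕ t ≡ elt τ a
  ⊕-tangibleˡ ∞ˢ            _   = refl
  ⊕-tangibleˡ {a} (elt _ b) a<b with compare a b
  ... | tri< _ _ _    = refl
  ... | tri≈ a≮b _ _  = ⊥-elim (a≮b a<b)
  ... | tri> a≮b _ _  = ⊥-elim (a≮b a<b)

  ⊕-tangibleʳ : ∀ {a} s → Above a s → s ⊕ elt τ a ≡ elt τ a
  ⊕-tangibleʳ ∞ˢ            _   = refl
  ⊕-tangibleʳ {a} (elt _ b) a<b with compare b a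
  ... | tri< _ _ a≮b  = ⊥-elim (a≮b a<b)
  ... | tri≈ _ _ a≮b  = ⊥-elim (a≮b a<b)
  ... | tri> _ _ _    = refl

  -- A tie produces a ghost, so a tangible sum is attained by exactly one of its terms.
  ⊕-tangible⁻ : ∀ {a} s t → s ⊕ t ≡ elt τ a →
                (s ≡ elt τ a × Above a t) ⊎ (t ≡ elt τ a × Above a s)
  ⊕-tangible⁻ ∞ˢ        t         eq   = inj₂ (eq , tt)
  ⊕-tangible⁻ (elt _ _) ∞ˢ        eq   = inj₁ (eq , tt)
  ⊕-tangible⁻ (elt _ b) (elt _ c) eq with compare b c | eq
  ... | tri< b<c _ _ | refl = inj₁ (refl , b<c)
  ... | tri> _ _ c<b | refl = inj₂ (refl , c<b)

  ⊙-above : ∀ {a b} s t → Above a s → Above b t → Above (a +ᴿ b) (s ⊙ t)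
  ⊙-above ∞ˢ        t         _ _ = tt
  ⊙-above (elt _ _) ∞ˢ        _ _ = tt
  ⊙-above (elt _ _) (elt _ _) p q = +ᴿ-mono-< p q

  ⊙-aboveˡ : ∀ {a b} t → Above b t → Above (a +ᴿ b) (elt τ a ⊙ t)
  ⊙-aboveˡ ∞ˢ            _ = tt
  ⊙-aboveˡ {a} (elt _ _) q = +ᴿ-monoˡ-< a q

  ⊙-aboveʳ : ∀ {a b} s → Above a s → Above (a +ᴿ b) (s ⊙ elt τ b)
  ⊙-aboveʳ ∞ˢ                _ = tt
  ⊙-aboveʳ {b = b} (elt _ _) p = +-mono-< b p

  module _ {X : Set} (f : X → 𝕊) where

    ⨁-above⁻ : ∀ {a} xs → Above a (⨁ (map f xs)) → ∀ {x} → x ∈ xs → Above a (f x)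
    ⨁-above⁻ (x ∷ xs) p (here refl) = proj₁ (⊕-above⁻ (f x) _ p)
    ⨁-above⁻ (x ∷ xs) p (there x∈)  = ⨁-above⁻ xs (proj₂ (⊕-above⁻ (f x) _ p)) x∈

    ⨁-above⁺ : ∀ {a} xs → (∀ {x} → x ∈ xs → Above a (f x)) → Above a (⨁ (map f xs))
    ⨁-above⁺ []       p = tt
    ⨁-above⁺ (x ∷ xs) p = ⊕-above⁺ (f x) _ (p (here refl)) (⨁-above⁺ xs (p ∘ there))

    ⨁-tangible⁻ : ∀ {a} xs → ⨁ (map f xs) ≡ elt τ a →
                  ∃ λ x → x ∈ xs × f x ≡ elt τ a × (∀ {y} → y ∈ xs → y ≢ x → Above a (f y))
    ⨁-tangible⁻ (x ∷ xs) eq with ⊕-tangible⁻ (f x) _ eq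
    ... | inj₁ (fx≡ , rest>) = x , here refl , fx≡ ,
      λ { (here refl) x≢x → ⊥-elim (x≢x refl) ; (there y∈) _ → ⨁-above⁻ xs rest> y∈ }
    ... | inj₂ (rest≡ , fx>) with ⨁-tangible⁻ xs rest≡
    ...   | z , z∈ , fz≡ , others = z , there z∈ , fz≡ ,
      λ { (here refl) _ → fx> ; (there y∈) y≢z → others y∈ y≢z }

    ⨁-tangible⁺ : ∀ {a x xs} → Unique xs → x ∈ xs → f x ≡ elt τ a →
                  (∀ {y} → y ∈ xs → y ≢ x → Above a (f y)) → ⨁ (map f xs) ≡ elt τ a
    ⨁-tangible⁺ {xs = x ∷ xs} u (here refl) fx≡ others rewrite fx≡ =
      ⊕-tangibleˡ (⨁ (map f xs)) (⨁-above⁺ xs λ y∈ → others (there y∈) λ { refl → Uniqueₚ.Unique[x∷xs]⇒x∉xs u y∈ })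
    ⨁-tangible⁺ {xs = y ∷ xs} u@(_ ∷ xs!) (there x∈) fx≡ others
      rewrite ⨁-tangible⁺ xs! x∈ fx≡ (others ∘ there) =
      ⊕-tangibleʳ (f y) (others (here refl) λ { refl → Uniqueₚ.Unique[x∷xs]⇒x∉xs u x∈ })

  module _ {X : Set} {g : X → 𝕊} where

    ⨀-elt : ∀ {v : X → ℝ} xs → (∀ {x} → x ∈ xs → ∃ λ i → g x ≡ elt i (v x)) →
            ∃ λ i → ⨀ (map g xs) ≡ elt i (∑ v xs)
    ⨀-elt []       h = τ , refl
    ⨀-elt (x ∷ xs) h with h (here refl) | ⨀-elt xs (h ∘ there)
    ... | i , gx≡ | j , rest≡ rewrite gx≡ | rest≡ = i ∧ˡ j , refl

    ⨀-tangible⁺ : ∀ {v : X → ℝ} xs → (∀ {x} → x ∈ xs → g x ≡ elt τ (v x)) →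
                  ⨀ (map g xs) ≡ elt τ (∑ v xs)
    ⨀-tangible⁺ []       h = refl
    ⨀-tangible⁺ (x ∷ xs) h rewrite h (here refl) | ⨀-tangible⁺ xs (h ∘ there) = refl

    ⨀-tangible⁻ : ∀ {a} xs → ⨀ (map g xs) ≡ elt τ a → ∀ {x} → x ∈ xs → Tangible (g x)
    ⨀-tangible⁻ (x ∷ xs) eq x∈ with g x in gx≡ | ⨀ (map g xs) in rest≡ | x∈
    ... | elt τ b | elt τ c | here refl = b , gx≡
    ... | elt τ b | elt τ c | there x∈′ = ⨀-tangible⁻ xs rest≡ x∈′

    ⨀-weak : ∀ {v : X → ℝ} xs → (∀ {x} → x ∈ xs → g x ≡ elt τ (v x) ⊎ Above (v x) (g x)) →
             ⨀ (map g xs) ≡ elt τ (∑ v xs) ⊎ Above (∑ v xs) (⨀ (map g xs))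
    ⨀-weak []       h = inj₁ refl
    ⨀-weak (x ∷ xs) h with h (here refl) | ⨀-weak xs (h ∘ there)
    ... | inj₁ gx≡ | inj₁ rest≡ rewrite gx≡ | rest≡ = inj₁ refl
    ... | inj₁ gx≡ | inj₂ rest> rewrite gx≡ = inj₂ (⊙-aboveˡ (⨀ (map g xs)) rest>)
    ... | inj₂ gx> | inj₁ rest≡ rewrite rest≡ = inj₂ (⊙-aboveʳ (g x) gx>)
    ... | inj₂ gx> | inj₂ rest> = inj₂ (⊙-above (g x) _ gx> rest>)

    -- Real parts add and addition is strictly monotone, so a single strict factor makes the whole
    -- bound strict.
    ⨀-above : ∀ {v : X → ℝ} xs → (∀ {x} → x ∈ xs → g x ≡ elt τ (v x) ⊎ Above (v x) (g x)) →
              ∀ {x} → x ∈ xs → Above (v x) (g x) → Above (∑ v xs) (⨀ (map g xs))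
    ⨀-above (x ∷ xs) h (here refl) gx> with ⨀-weak xs (h ∘ there)
    ... | inj₁ rest≡ rewrite rest≡ = ⊙-aboveʳ (g x) gx>
    ... | inj₂ rest> = ⊙-above (g x) _ gx> rest>
    ⨀-above (x ∷ xs) h (there x∈) gx> with h (here refl) | ⨀-above xs (h ∘ there) x∈ gx>
    ... | inj₁ gx≡ | rest> rewrite gx≡ = ⊙-aboveˡ (⨀ (map g xs)) rest>
    ... | inj₂ gy> | rest> = ⊙-above (g x) _ gy> rest>

  -- The exchange graph of an optimal permutation and its potentials.

  weights : ℝ → 𝕊 → List ℝ
  weights c ∞ˢ        = []
  weights c (elt _ v) = [ v +ᴿ - c ]

  -- The value at `∞ˢ` is a mere default: the function is evaluated along permutations whose entries
  -- are all finite.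
  excess : ℝ → 𝕊 → ℝ
  excess c ∞ˢ        = 0ℝ
  excess c (elt _ v) = v +ᴿ - c

  +ᴿ-excess : ∀ c v → c +ᴿ (v +ᴿ - c) ≡ v
  +ᴿ-excess c v = trans (+ᴿ-comm c _) (//-rightDividesˡ c v)

  ∈-weights : ∀ {c r} s → r ∈ weights c s → r ≡ excess c s × ∃ λ i → s ≡ elt i (c +ᴿ excess c s)
  ∈-weights {c} (elt i v) (here refl) = refl , i , cong (elt i) (sym (+ᴿ-excess c v))

  module _ {k} (B : Fin k → Fin k → 𝕊) (b : Fin k → ℝ) (tangible : ∀ x → B x x ≡ elt τ (b x))
           (optimal : ∀ {π} → Injective _≡_ _≡_ π → ∀ x → π x ≢ x →
                      Above (∑ b (allFin k)) (⨀ (map (λ i → B i (π i)) (allFin k))))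
           where

    -- Switching from the matched column of row `x` to column `y` costs the weight of the arc.
    -- Diagonal entries would give loops of weight 0 and spoil positivity, so they are left out.
    arcs : Fin k → Fin k → List ℝ
    arcs x y with x ≟ y
    ... | yes _ = []
    ... | no _  = weights (b x) (B x y)

    ∈-arcs⁻ : ∀ {x y r} → r ∈ arcs x y → x ≢ y × r ∈ weights (b x) (B x y)
    ∈-arcs⁻ {x} {y} r∈ with x ≟ y
    ... | no x≢y = x≢y , r∈

    ∈-arcs⁺ : ∀ {x y r} → x ≢ y → r ∈ weights (b x) (B x y) → r ∈ arcs x y
    ∈-arcs⁺ {x} {y} x≢y r∈ with x ≟ y
    ... | yes x≡y = ⊥-elim (x≢y x≡y)
    ... | no _    = r∈

    -- Rotating along the cycle gives a permutation `σ` that moves `x`, so its product lies strictly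
    -- above that of the identity. The difference of the two is the weight of the cycle, because
    -- fixed points contribute 0.
    simpleCyclesPositive : SimpleCyclesPositive arcs
    simpleCyclesPositive {x} {l} {r} u w with cycle x l u
    ... | σ , inj , shifts , fixes = subst (0ℝ <ᴿ_) total 0<total
      where
      e : Fin k → ℝ
      e v = excess (b v) (B v (σ v))
      Finite : Fin k → Set
      Finite v = ∃ λ i → B v (σ v) ≡ elt i (b v +ᴿ e v)

      along : ∀ {x l y r} → Walk arcs x l y r → map σ (x ∷ l) ≡ l ++ [ y ] →
              r ≡ ∑ e (x ∷ l) × (∀ {v} → v ∈ x ∷ l → Finite v)
      along {x} (edge {r = r} r∈) eq with ∷-injectiveˡ eq
      ... | refl with ∈-weights (B x (σ x)) (proj₂ (∈-arcs⁻ r∈))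
      ...   | r≡ , ok = trans r≡ (sym (+ᴿ-identityʳ _)) , λ { (here refl) → ok }
      along {x} (r∈ ◂ w) eq with ∷-injective eq
      ... | refl , eq′ with ∈-weights (B x (σ x)) (proj₂ (∈-arcs⁻ r∈)) | along w eq′
      ...   | r≡ , ok | s≡ , oks = cong₂ _+ᴿ_ r≡ s≡ , λ { (here refl) → ok ; (there v∈) → oks v∈ }

      moved : ∀ {x l y r} → Walk arcs x l y r → map σ (x ∷ l) ≡ l ++ [ y ] → σ x ≢ x
      moved (edge r∈) eq σx≡x = proj₁ (∈-arcs⁻ r∈) (trans (sym σx≡x) (∷-injectiveˡ eq))
      moved (r∈ ◂ _)  eq σx≡x = proj₁ (∈-arcs⁻ r∈) (trans (sym σx≡x) (∷-injectiveˡ eq))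

      unmoved : ∀ v → v ∉ x ∷ l → B v (σ v) ≡ elt τ (b v)
      unmoved v v∉ = trans (cong (B v) (fixes v v∉)) (tangible v)

      e-unmoved : ∀ v → v ∉ x ∷ l → e v ≡ 0ℝ
      e-unmoved v v∉ = trans (cong (excess (b v)) (unmoved v v∉)) (-‿inverseʳ (b v))

      finite : ∀ v → Finite v
      finite v with v ∈? (x ∷ l)
        where open import Data.List.Membership.DecPropositional (_≟_ {k}) using (_∈?_)
      ... | yes v∈ = proj₂ (along w shifts) v∈
      ... | no v∉  = τ , trans (unmoved v v∉) (cong (elt τ)
        (sym (trans (cong (b v +ᴿ_) (e-unmoved v v∉)) (+ᴿ-identityʳ (b v)))))

      total : ∑ e (allFin k) ≡ r
      total = trans (∑-support e u e-unmoved) (sym (proj₁ (along w shifts)))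

      0<total : 0ℝ <ᴿ ∑ e (allFin k)
      0<total = +ᴿ-cancelˡ-< (∑ b (allFin k)) (subst₂ _<ᴿ_ (sym (+ᴿ-identityʳ _)) (∑-+ b e (allFin k))
        (subst (Above _) (proj₂ (⨀-elt {v = λ v → b v +ᴿ e v} (allFin k) (λ {v} _ → finite v)))
               (optimal inj x (moved w shifts))))

    -- Take `u` as column potential and `b x - u x` as row potential. The diagonal is then met
    -- exactly, and the constraint of an arc rearranges to the bound on the off-diagonal entry.
    optimal⇒potential : ∃ λ u → ∀ {x y} → x ≢ y → Above ((b x +ᴿ - u x) +ᴿ u y) (B x y)
    optimal⇒potential with potential arcs (cyclesPositive simpleCyclesPositive)
    ... | u , u-ok = u , λ {x} {y} x≢y → above (B x y) (λ r∈ → u-ok (∈-arcs⁺ x≢y r∈))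
      where
      above : ∀ {x y} s → (∀ {r} → r ∈ weights (b x) s → u y <ᴿ r +ᴿ u x) →
              Above ((b x +ᴿ - u x) +ᴿ u y) s
      above ∞ˢ _ = tt
      above {x} {y} (elt _ v) h = +ᴿ-cancelʳ-< (u x) (subst₂ _<ᴿ_ left right (+ᴿ-monoˡ-< (b x) (h (here refl))))
        where
        left : b x +ᴿ u y ≡ b x +ᴿ - u x +ᴿ u y +ᴿ u x
        left = sym (trans (xy∙z≈xz∙y (b x +ᴿ - u x) (u y) (u x)) (cong (_+ᴿ u y) (//-rightDividesˡ (u x) (b x))))
        right : b x +ᴿ (v +ᴿ - b x +ᴿ u x) ≡ v +ᴿ u x
        right = trans (sym (+ᴿ-assoc _ _ _)) (cong (_+ᴿ u x) (+ᴿ-excess (b x) v))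

  -- Strict potentials as dual certificates of the assignment problem.

  record Dominant (V : Set) {R C : Set} (A : R → C → 𝕊) : Set where
    field
      row      : V → R
      col      : V → C
      y z      : V → ℝ
      diagonal : ∀ a → A (row a) (col a) ≡ elt τ (y a +ᴿ z a)
      off      : ∀ {a b} → a ≢ b → Above (y a +ᴿ z b) (A (row a) (col b))

    off-diagonal-< : ∀ {a b c} → A (row a) (col b) ≡ elt τ c → a ≢ b → y a +ᴿ z b <ᴿ c
    off-diagonal-< eq a≢b = subst (Above _) eq (off a≢b)

  module _ {R C : Set} {A : R → C → 𝕊} where

    -- Certificates have an arbitrary index type so that the enlarged matrix can be indexed by a
    -- disjoint union; this lemma returns to an index set of the form `Fin n`.
    pullback : ∀ {V W : Set} (f : W → V) → Injective _≡_ _≡_ f → Dominant V A → Dominant W A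
    pullback f inj D = record
      { row = row ∘ f ; col = col ∘ f ; y = y ∘ f ; z = z ∘ f
      ; diagonal = diagonal ∘ f ; off = λ a≢b → off (a≢b ∘ inj) }
      where open Dominant D

    weight : ∀ {k} → (Fin k → R) → (Fin k → C) → Vec (Fin k) k → 𝕊
    weight {k} ρ κ σ = ⨀ (map (λ i → A (ρ i) (κ (lookup σ i))) (allFin k))

    module _ {k} (D : Dominant (Fin k) A) where
      open Dominant D

      -- If `a` and `b` shared a row, comparing in column `b` would give `y a < y b`, and comparing
      -- in column `a` the reverse.
      row-injective : Injective _≡_ _≡_ row
      row-injective {a} {b} eq with a ≟ b
      ... | yes a≡b = a≡b
      ... | no a≢b = ⊥-elim (<-irrefl refl (<-trans
        (+ᴿ-cancelʳ-< (z b) (off-diagonal-< (trans (cong (λ r → A r (col b)) eq) (diagonal b)) a≢b))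
        (+ᴿ-cancelʳ-< (z a) (off-diagonal-< (trans (cong (λ r → A r (col a)) (sym eq)) (diagonal a)) (a≢b ∘ sym)))))

      col-injective : Injective _≡_ _≡_ col
      col-injective {a} {b} eq with a ≟ b
      ... | yes a≡b = a≡b
      ... | no a≢b = ⊥-elim (<-irrefl refl (<-trans
        (+ᴿ-cancelˡ-< (y a) (off-diagonal-< (trans (cong (A (row a)) (sym eq)) (diagonal a)) a≢b))
        (+ᴿ-cancelˡ-< (y b) (off-diagonal-< (trans (cong (A (row b)) eq) (diagonal b)) (a≢b ∘ sym)))))

      -- The sum of `y i + z (σ i)` over `i` is the same for every permutation `σ`. The identity
      -- attains it, and any other permutation uses an off-diagonal entry and lies strictly above.
      dominant⇒nonSingular : HasNonSingSub A k
      dominant⇒nonSingular = row , col , row-injective , col-injective , _ ,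
        ⨁-tangible⁺ (weight row col) (perms-unique k) (∈-perms⁺ id) identity others
        where
        total : ℝ
        total = ∑ (λ i → y i +ᴿ z i) (allFin k)
        identity : weight row col (Vec.tabulate id) ≡ elt τ total
        identity = ⨀-tangible⁺ (allFin k) λ {i} _ →
          trans (cong (A (row i) ∘ col) (lookup∘tabulate id i)) (diagonal i)
        others : ∀ {σ} → σ ∈ perms k → σ ≢ Vec.tabulate id → Above total (weight row col σ)
        others {σ} σ∈ σ≢id with ¬∀⟶∃¬ k _ (λ i → lookup σ i ≟ i)
            (λ fixed → σ≢id (trans (sym (tabulate∘lookup σ)) (tabulate-cong fixed)))
        ... | i , σi≢i = subst (λ t → Above t (weight row col σ)) total≡
            (⨀-above {v = λ i → y i +ᴿ z (lookup σ i)} (allFin k) (λ {j} _ → weak j) (∈-allFin i) (off (σi≢i ∘ sym)))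
          where
          weak : ∀ j → A (row j) (col (lookup σ j)) ≡ elt τ (y j +ᴿ z (lookup σ j)) ⊎
                       Above (y j +ᴿ z (lookup σ j)) (A (row j) (col (lookup σ j)))
          weak j with j ≟ lookup σ j
          ... | yes j≡ = inj₁ (subst (λ i → A (row j) (col i) ≡ elt τ (y j +ᴿ z i)) j≡ (diagonal j))
          ... | no j≢  = inj₂ (off j≢)
          total≡ : ∑ (λ i → y i +ᴿ z (lookup σ i)) (allFin k) ≡ total
          total≡ = begin
            ∑ (λ i → y i +ᴿ z (lookup σ i)) (allFin k)           ≡⟨ ∑-+ y (z ∘ lookup σ) (allFin k) ⟩
            ∑ y (allFin k) +ᴿ ∑ (z ∘ lookup σ) (allFin k)        ≡⟨ cong (∑ y (allFin k) +ᴿ_) (∑-injective z (perms-injective σ∈)) ⟩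
            ∑ y (allFin k) +ᴿ ∑ z (allFin k)                     ≡⟨ ∑-+ y z (allFin k) ⟨
            total                                                ∎
            where open ≡-Reasoning

    module _ {k} (ρ : Fin k → R) (κ : Fin k → C) {σ a}
             (σ∈ : σ ∈ perms k) (σ≡ : weight ρ κ σ ≡ elt τ a)
             (others : ∀ {π} → π ∈ perms k → π ≢ σ → Above a (weight ρ κ π)) where

      matched : Fin k → Fin k → 𝕊
      matched x y = A (ρ x) (κ (lookup σ y))

      matched-tangible : ∀ x → Tangible (matched x x)
      matched-tangible x = ⨀-tangible⁻ (allFin k) σ≡ (∈-allFin x)

      matchedValue : Fin k → ℝ
      matchedValue x = proj₁ (matched-tangible x)

      a≡∑matchedValue : a ≡ ∑ matchedValue (allFin k)
      a≡∑matchedValue = elt-injective (trans (sym σ≡) (⨀-tangible⁺ (allFin k) (λ {x} _ → proj₂ (matched-tangible x))))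

      -- Once the columns are reordered by `σ`, a permutation `π` stands for the original
      -- permutation `σ ∘ π`, which differs from `σ` as soon as `π` moves a point.
      matched-optimal : ∀ {π} → Injective _≡_ _≡_ π → ∀ x → π x ≢ x →
                  Above (∑ matchedValue (allFin k)) (⨀ (map (λ i → matched i (π i)) (allFin k)))
      matched-optimal {π} inj x πx≢x = subst₂ Above a≡∑matchedValue
        (cong ⨀ (map-cong (λ i → cong (λ j → A (ρ i) (κ j)) (lookup∘tabulate (lookup σ ∘ π) i)) (allFin k)))
        (others (∈-perms⁺ (λ eq → inj (perms-injective σ∈ eq)))
          λ eq → πx≢x (perms-injective σ∈
            (trans (sym (lookup∘tabulate (lookup σ ∘ π) x)) (cong (λ v → lookup v x) eq))))

      optimum⇒dominant : Dominant (Fin k) A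
      optimum⇒dominant = record
        { row = ρ ; col = λ x → κ (lookup σ x) ; y = λ x → matchedValue x +ᴿ - u x ; z = u
        ; diagonal = λ x → trans (proj₂ (matched-tangible x)) (cong (elt τ) (sym (//-rightDividesˡ (u x) (matchedValue x))))
        ; off = proj₂ found }
        where
        found : ∃ λ u → ∀ {x y} → x ≢ y → Above ((matchedValue x +ᴿ - u x) +ᴿ u y) (matched x y)
        found = optimal⇒potential matched matchedValue (λ x → proj₂ (matched-tangible x)) matched-optimal
        u : Fin k → ℝ
        u = proj₁ found

    nonSingular⇒dominant : ∀ {k} → HasNonSingSub A k → Dominant (Fin k) A
    nonSingular⇒dominant {k} (ρ , κ , _ , _ , a , per≡) =
      let σ , σ∈ , σ≡ , others = ⨁-tangible⁻ (weight ρ κ) (perms k) per≡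
      in optimum⇒dominant ρ κ σ∈ σ≡ others

  -- Slack in strict inequalities, and selection of rows by the pigeonhole principle.

  above⇒<weights : ∀ {a c} s → Above (a +ᴿ c) s → a <ˡ weights c s
  above⇒<weights {a} {c} (elt _ v) lt (here refl) =
    +ᴿ-cancelʳ-< c (subst (a +ᴿ c <ᴿ_) (sym (//-rightDividesˡ c v)) lt)

  <weights⇒above : ∀ {a c} s → a <ˡ weights c s → Above (a +ᴿ c) s
  <weights⇒above ∞ˢ _ = tt
  <weights⇒above {a} {c} (elt _ v) lt = subst (a +ᴿ c <ᴿ_) (//-rightDividesˡ c v) (+-mono-< c (lt (here refl)))

  module _ {k} (v : Fin k → 𝕊) (z : Fin k → ℝ) where

    slack : List ℝ
    slack = gather λ s → weights (z s) (v s)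

    <slack⇒above : ∀ {a} → a <ˡ slack → ∀ s → Above (a +ᴿ z s) (v s)
    <slack⇒above lt s = <weights⇒above (v s) (lt ∘ ∈-gather⁺ _ s)

    -- Finitely many strict inequalities leave room for a larger potential; this supplies the one
    -- for the second copy of a chosen row.
    above-raise : ∀ {a} → (∀ s → Above (a +ᴿ z s) (v s)) →
                  ∃ λ c → a <ᴿ c × (∀ s → Above (c +ᴿ z s) (v s))
    above-raise above with raise slack
      (λ r∈ → let s , r∈s = ∈-gather⁻ _ r∈ in above⇒<weights (v s) (above s) r∈s)
    ... | c , a<c , c< = c , a<c , <slack⇒above c<

    above-exists : ∃ λ c → ∀ s → Above (c +ᴿ z s) (v s)
    above-exists = let c , c< = below slack in c , <slack⇒above c<

  -- The `p` fibres have at most two elements each, so `k + p` elements fill at least `k` of them.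
  -- In each full fibre `g` names an element of least `y` and `h` the other one.
  select : ∀ k {p} (f : Fin (k + p) → Fin p) (y : Fin (k + p) → ℝ) →
           (∀ {a b c} → f a ≡ f b → f b ≡ f c → a ≡ b ⊎ a ≡ c ⊎ b ≡ c) →
           ∃₂ λ (g h : Fin k → Fin (k + p)) → Injective _≡_ _≡_ (f ∘ g) ×
             (∀ t → h t ≢ g t × f (h t) ≡ f (g t) × ¬ (y (h t) <ᴿ y (g t)))
  select zero    f y fibres = (λ ()) , (λ ()) , (λ { {()} }) , λ ()
  select (suc k) {p} f y fibres = g , h , injective , props
    where
    collision : ∃₂ λ a b → b ≢ a × f b ≡ f a × ¬ (y b <ᴿ y a)
    collision with pigeonhole (s≤s (ℕₚ.m≤n+m p k)) f
    ... | i , j , i<j , fi≡fj with compare (y i) (y j)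
    ...   | tri< _ _ yj≮yi = i , j , (λ { refl → <ᶠ-irrefl refl i<j }) , sym fi≡fj , yj≮yi
    ...   | tri≈ _ _ yj≮yi = i , j , (λ { refl → <ᶠ-irrefl refl i<j }) , sym fi≡fj , yj≮yi
    ...   | tri> yi≮yj _ _ = j , i , (λ { refl → <ᶠ-irrefl refl i<j }) , fi≡fj , yi≮yj
    a b : Fin (suc k + p)
    a = proj₁ collision
    b = proj₁ (proj₂ collision)
    -- Only `a` is removed, which lowers the count by one. Its fibre keeps at most one element and
    -- so cannot take part in a later collision.
    ι : Fin (k + p) → Fin (suc k + p)
    ι = punchIn a
    ι-injective : Injective _≡_ _≡_ ι
    ι-injective = punchIn-injective a _ _
    rest : ∃₂ λ (g h : Fin k → Fin (k + p)) → Injective _≡_ _≡_ (f ∘ ι ∘ g) ×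
             (∀ t → h t ≢ g t × f (ι (h t)) ≡ f (ι (g t)) × ¬ (y (ι (h t)) <ᴿ y (ι (g t))))
    rest = select k (f ∘ ι) (y ∘ ι) λ eq₁ eq₂ → pull (fibres eq₁ eq₂)
      where
      pull : ∀ {i j l} → ι i ≡ ι j ⊎ ι i ≡ ι l ⊎ ι j ≡ ι l → i ≡ j ⊎ i ≡ l ⊎ j ≡ l
      pull (inj₁ eq)        = inj₁ (ι-injective eq)
      pull (inj₂ (inj₁ eq)) = inj₂ (inj₁ (ι-injective eq))
      pull (inj₂ (inj₂ eq)) = inj₂ (inj₂ (ι-injective eq))
    g′ h′ : Fin k → Fin (k + p)
    g′ = proj₁ rest
    h′ = proj₁ (proj₂ rest)
    g h : Fin (suc k) → Fin (suc k + p)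
    g zero    = a
    g (suc t) = ι (g′ t)
    h zero    = b
    h (suc t) = ι (h′ t)
    props : ∀ t → h t ≢ g t × f (h t) ≡ f (g t) × ¬ (y (h t) <ᴿ y (g t))
    props zero    = proj₂ (proj₂ collision)
    props (suc t) = let h≢g , rest′ = proj₂ (proj₂ (proj₂ rest)) t in h≢g ∘ ι-injective , rest′
    new-fibre : ∀ t → f a ≢ f (ι (g′ t))
    new-fibre t eq with fibres eq (sym (proj₁ (proj₂ (props (suc t)))))
    ... | inj₁ a≡g        = punchInᵢ≢i a (g′ t) (sym a≡g)
    ... | inj₂ (inj₁ a≡h) = punchInᵢ≢i a (h′ t) (sym a≡h)
    ... | inj₂ (inj₂ g≡h) = proj₁ (props (suc t)) (sym g≡h)
    injective : Injective _≡_ _≡_ (f ∘ g)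
    injective {zero}  {zero}  _  = refl
    injective {zero}  {suc t} eq = ⊥-elim (new-fibre t eq)
    injective {suc t} {zero}  eq = ⊥-elim (new-fibre t (sym eq))
    injective {suc s} {suc t} eq = cong suc (proj₁ (proj₂ (proj₂ rest)) eq)

  -- Symmetrized matrices and the entries of `Σᵀ`.

  base : ∀ {p} → Fin p ⊎ Fin p → Fin p
  base = reduce

  base-fibres : ∀ {p} (r s t : Fin p ⊎ Fin p) → base r ≡ base s → base s ≡ base t → r ≡ s ⊎ r ≡ t ⊎ s ≡ t
  base-fibres (inj₁ _) (inj₁ _) _        refl _    = inj₁ refl
  base-fibres (inj₂ _) (inj₂ _) _        refl _    = inj₁ refl
  base-fibres (inj₁ _) (inj₂ _) (inj₁ _) refl refl = inj₂ (inj₁ refl)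
  base-fibres (inj₂ _) (inj₁ _) (inj₂ _) refl refl = inj₂ (inj₁ refl)
  base-fibres (inj₁ _) (inj₂ _) (inj₂ _) refl refl = inj₂ (inj₂ refl)
  base-fibres (inj₂ _) (inj₁ _) (inj₁ _) refl refl = inj₂ (inj₂ refl)

  module _ {p q} (T : Fin p ⊎ Fin p → Fin p ⊎ Fin q → ℝ̄) (sym-T : Symmetrized p q T) where

    T-base : ∀ r → T r (inj₁ (base r)) ≡ fin 0ℝ
    T-base (inj₁ i) = proj₁ (proj₁ sym-T i)
    T-base (inj₂ i) = proj₂ (proj₁ sym-T i)

    T-off-base : ∀ r {i} → i ≢ base r → T r (inj₁ i) ≡ ∞
    T-off-base (inj₁ i) i′≢i = proj₁ (proj₂ sym-T i _ i′≢i)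
    T-off-base (inj₂ i) i′≢i = proj₂ (proj₂ sym-T i _ i′≢i)

    Σᵀ-tangible⁺ : ∀ {r s j a} → base s ≡ base r → s ≢ r →
                   asSuper T r (inj₂ j) ≡ elt τ a → Above a (asSuper T s (inj₂ j)) →
                   Σᵀ p q T (base r) j ≡ elt τ a
    Σᵀ-tangible⁺ {inj₁ i} {inj₁ _} refl s≢r _ _ = ⊥-elim (s≢r refl)
    Σᵀ-tangible⁺ {inj₂ i} {inj₂ _} refl s≢r _ _ = ⊥-elim (s≢r refl)
    Σᵀ-tangible⁺ {inj₁ i} {inj₂ _} {j} refl _ eq above rewrite eq = ⊕-tangibleˡ (T (inj₂ i) (inj₂ j) ^τ) above
    Σᵀ-tangible⁺ {inj₂ i} {inj₁ _} {j} refl _ eq above rewrite eq = ⊕-tangibleʳ (T (inj₁ i) (inj₂ j) ^τ) above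

    Σᵀ-above⁺ : ∀ {r s j a} → base s ≡ base r → s ≢ r →
                Above a (asSuper T r (inj₂ j)) → Above a (asSuper T s (inj₂ j)) →
                Above a (Σᵀ p q T (base r) j)
    Σᵀ-above⁺ {inj₁ i} {inj₁ _} refl s≢r _ _ = ⊥-elim (s≢r refl)
    Σᵀ-above⁺ {inj₂ i} {inj₂ _} refl s≢r _ _ = ⊥-elim (s≢r refl)
    Σᵀ-above⁺ {inj₁ i} {inj₂ _} {j} refl _ r> s> = ⊕-above⁺ (T (inj₁ i) (inj₂ j) ^τ) (T (inj₂ i) (inj₂ j) ^τ) r> s>
    Σᵀ-above⁺ {inj₂ i} {inj₁ _} {j} refl _ r> s> = ⊕-above⁺ (T (inj₁ i) (inj₂ j) ^τ) (T (inj₂ i) (inj₂ j) ^τ) s> r>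

    Σᵀ-above⁻ : ∀ {j a} r → Above a (Σᵀ p q T (base r) j) → Above a (asSuper T r (inj₂ j))
    Σᵀ-above⁻ {j} (inj₁ i) above = proj₁ (⊕-above⁻ (T (inj₁ i) (inj₂ j) ^τ) (T (inj₂ i) (inj₂ j) ^τ) above)
    Σᵀ-above⁻ {j} (inj₂ i) above = proj₂ (⊕-above⁻ (T (inj₁ i) (inj₂ j) ^τ) (T (inj₂ i) (inj₂ j) ^τ) above)

    Σᵀ-tangible⁻ : ∀ i j {a} → Σᵀ p q T i j ≡ elt τ a →
                   ∃₂ λ r s → base r ≡ i × base s ≡ i ×
                     asSuper T r (inj₂ j) ≡ elt τ a × Above a (asSuper T s (inj₂ j))
    Σᵀ-tangible⁻ i j eq with ⊕-tangible⁻ (T (inj₁ i) (inj₂ j) ^τ) (T (inj₂ i) (inj₂ j) ^τ) eq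
    ... | inj₁ (r≡ , s>) = inj₁ i , inj₂ i , refl , refl , r≡ , s>
    ... | inj₂ (r≡ , s>) = inj₂ i , inj₁ i , refl , refl , r≡ , s>

    -- Extending potentials from `Σᵀ` to `T`.

    module _ {k} (D : Dominant (Fin k) (Σᵀ p q T)) where
      open Dominant D

      copies : ∀ t → ∃₂ λ r s → base r ≡ row t × base s ≡ row t ×
                 asSuper T r (inj₂ (col t)) ≡ elt τ (y t +ᴿ z t) ×
                 Above (y t +ᴿ z t) (asSuper T s (inj₂ (col t)))
      copies t = Σᵀ-tangible⁻ (row t) (col t) (diagonal t)

      copy-above : ∀ {t u} r → base r ≡ row t → t ≢ u → Above (y t +ᴿ z u) (asSuper T r (inj₂ (col u)))
      copy-above {t} {u} r eq t≢u =
        Σᵀ-above⁻ r (subst (λ i → Above _ (Σᵀ p q T i (col u))) (sym eq) (off t≢u))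

      -- The copy `r` is to be matched to column `i`, with row potential `c` and column potential
      -- `- c`. If the other copy of row `i` is in use with potential `y t`, its entry 0 in column
      -- `i` must exceed `y t - c`, whence `y t < c`.
      Completion : Fin p → Set
      Completion i = ∃₂ λ r c → base r ≡ i ×
        (∀ s → Above (c +ᴿ z s) (asSuper T r (inj₂ (col s)))) × (∀ t → row t ≡ i → y t <ᴿ c)

      completion : ∀ i → Completion i
      completion i with any? (λ t → row t ≟ i)
      -- Row `i` is not chosen, so either copy serves and any sufficiently small potential works.
      ... | no i∉ = let c , above = above-exists (λ s → asSuper T (inj₁ i) (inj₂ (col s))) z in
        inj₁ i , c , refl , above , λ t eq → ⊥-elim (i∉ (t , eq))
      -- The copy that does not attain the tangible minimum is strictly above in column `col t` too,
      -- so `y t` can be raised for it. Injectivity of `row` makes `t` the only index to compare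
      -- with.
      ... | yes (t , refl) =
        let _ , r , _ , base-r , _ , r> = copies t
            c , y<c , above = above-raise (λ s → asSuper T r (inj₂ (col s))) z (r-above r base-r r>)
        in r , c , base-r , above , λ t′ eq → subst (λ t → y t <ᴿ c) (sym (row-injective D eq)) y<c
        where
        r-above : ∀ r → base r ≡ row t → Above (y t +ᴿ z t) (asSuper T r (inj₂ (col t))) →
                  ∀ s → Above (y t +ᴿ z s) (asSuper T r (inj₂ (col s)))
        r-above r base-r r> s with t ≟ s
        ... | yes refl = r>
        ... | no t≢s   = copy-above r base-r t≢s

      extend : Dominant (Fin k ⊎ Fin p) (asSuper T)
      extend = record { row = row′ ; col = col′ ; y = y′ ; z = z′ ; diagonal = diagonal′ ; off = off′ }
        where
        row′ : Fin k ⊎ Fin p → Fin p ⊎ Fin p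
        row′ (inj₁ t) = proj₁ (copies t)
        row′ (inj₂ i) = proj₁ (completion i)
        col′ : Fin k ⊎ Fin p → Fin p ⊎ Fin q
        col′ (inj₁ t) = inj₂ (col t)
        col′ (inj₂ i) = inj₁ i
        y′ z′ : Fin k ⊎ Fin p → ℝ
        y′ (inj₁ t) = y t
        y′ (inj₂ i) = proj₁ (proj₂ (completion i))
        z′ (inj₁ t) = z t
        -- The matched entry in column `i` is 0, which forces the two potentials to be opposite.
        z′ (inj₂ i) = - y′ (inj₂ i)
        base-row : ∀ t → base (row′ (inj₁ t)) ≡ row t
        base-row t = proj₁ (proj₂ (proj₂ (copies t)))
        base-completion : ∀ i → base (row′ (inj₂ i)) ≡ i
        base-completion i = proj₁ (proj₂ (proj₂ (completion i)))
        diagonal′ : ∀ a → asSuper T (row′ a) (col′ a) ≡ elt τ (y′ a +ᴿ z′ a)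
        diagonal′ (inj₁ t) = proj₁ (proj₂ (proj₂ (proj₂ (proj₂ (copies t)))))
        diagonal′ (inj₂ i) = begin
          T r (inj₁ i) ^τ          ≡⟨ cong (λ j → T r (inj₁ j) ^τ) (base-completion i) ⟨
          T r (inj₁ (base r)) ^τ   ≡⟨ cong _^τ (T-base r) ⟩
          elt τ 0ℝ                 ≡⟨ cong (elt τ) (-‿inverseʳ (y′ (inj₂ i))) ⟨
          elt τ (y′ (inj₂ i) +ᴿ - y′ (inj₂ i)) ∎
          where
          open ≡-Reasoning
          r : Fin p ⊎ Fin p
          r = row′ (inj₂ i)
        -- Column `i` is infinite outside the two copies of row `i`, so the bound has to be checked
        -- on these copies only.
        at-column-i : ∀ r i {c} → (base r ≡ i → c <ᴿ 0ℝ) → Above c (asSuper T r (inj₁ i))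
        at-column-i r i c<0 with i ≟ base r
        ... | yes refl rewrite T-base r = c<0 refl
        ... | no i≢ rewrite T-off-base r i≢ = tt
        off′ : ∀ {a b} → a ≢ b → Above (y′ a +ᴿ z′ b) (asSuper T (row′ a) (col′ b))
        off′ {inj₁ t} {inj₁ s} a≢b = copy-above (row′ (inj₁ t)) (base-row t) (a≢b ∘ cong inj₁)
        off′ {inj₁ t} {inj₂ i} _   = at-column-i (row′ (inj₁ t)) i λ base≡i →
          subst (y t +ᴿ z′ (inj₂ i) <ᴿ_) (-‿inverseʳ (y′ (inj₂ i)))
            (+-mono-< _ (proj₂ (proj₂ (proj₂ (proj₂ (completion i)))) t (trans (sym (base-row t)) base≡i)))
        off′ {inj₂ i} {inj₁ s} _   = proj₁ (proj₂ (proj₂ (proj₂ (completion i)))) s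
        off′ {inj₂ i} {inj₂ j} a≢b = at-column-i (row′ (inj₂ i)) j λ base≡j →
          ⊥-elim (a≢b (cong inj₂ (trans (sym (base-completion i)) base≡j)))

    -- Restricting potentials from `T` to `Σᵀ`.

    contract : ∀ {k} → Dominant (Fin (k + p)) (asSuper T) → Dominant (Fin k) (Σᵀ p q T)
    contract {k} D = record
      { row = λ t → base (row (g t)) ; col = λ t → proj₁ (col-J t) ; y = y ∘ g ; z = z ∘ g
      ; diagonal = λ t → Σᵀ-tangible⁺ (base-h t) (row-h≢g t) (at-J t (diagonal (g t)))
                           (at-J′ t (h-above t t))
      ; off = λ {t} {s} t≢s → Σᵀ-above⁺ (base-h t) (row-h≢g t)
                (at-J′ s (off (t≢s ∘ fg-injective ∘ cong (base ∘ row)))) (at-J′ s (h-above t s)) }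
      where
      open Dominant D
      selection : ∃₂ λ (g h : Fin k → Fin (k + p)) → Injective _≡_ _≡_ (base ∘ row ∘ g) ×
                    (∀ t → h t ≢ g t × base (row (h t)) ≡ base (row (g t)) × ¬ (y (h t) <ᴿ y (g t)))
      selection = select k (base ∘ row) y λ {a} {b} {c} eq₁ eq₂ →
        pull (base-fibres (row a) (row b) (row c) eq₁ eq₂)
        where
        pull : ∀ {a b c} → row a ≡ row b ⊎ row a ≡ row c ⊎ row b ≡ row c → a ≡ b ⊎ a ≡ c ⊎ b ≡ c
        pull (inj₁ eq)        = inj₁ (row-injective D eq)
        pull (inj₂ (inj₁ eq)) = inj₂ (inj₁ (row-injective D eq))
        pull (inj₂ (inj₂ eq)) = inj₂ (inj₂ (row-injective D eq))
      g h : Fin k → Fin (k + p)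
      g = proj₁ selection
      h = proj₁ (proj₂ selection)
      fg-injective : Injective _≡_ _≡_ (base ∘ row ∘ g)
      fg-injective = proj₁ (proj₂ (proj₂ selection))
      h≢g : ∀ t → h t ≢ g t
      h≢g t = proj₁ (proj₂ (proj₂ (proj₂ selection)) t)
      base-h : ∀ t → base (row (h t)) ≡ base (row (g t))
      base-h t = proj₁ (proj₂ (proj₂ (proj₂ (proj₂ selection)) t))
      yh≮yg : ∀ t → ¬ (y (h t) <ᴿ y (g t))
      yh≮yg t = proj₂ (proj₂ (proj₂ (proj₂ (proj₂ selection)) t))
      row-h≢g : ∀ t → row (h t) ≢ row (g t)
      row-h≢g t = h≢g t ∘ row-injective D

      -- Row `h t` has the larger potential, so its own bound implies the one with `y (g t)`. That
      -- bound is strict in every selected column: `h t` shares its base with `g t` alone among the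
      -- selected rows, and differs from it. Hence the diagonal minimum over both copies has no tie.
      h-above : ∀ t s → Above (y (g t) +ᴿ z (g s)) (asSuper T (row (h t)) (col (g s)))
      h-above t s = Above-≮ (asSuper T (row (h t)) (col (g s)))
        (yh≮yg t ∘ +ᴿ-cancelʳ-< (z (g s)))
        (off λ h≡g → h≢g t (trans h≡g (cong g (fg-injective
          (trans (cong (base ∘ row) (sym h≡g)) (base-h t))))))

      -- Column i contains the same entry 0 in both copies of row i, so the copy with
      -- the smaller potential cannot be the one matched to it.
      col-J : ∀ t → ∃ λ j → col (g t) ≡ inj₂ j
      col-J t with col (g t) in col≡
      ... | inj₂ j = j , refl
      ... | inj₁ i with i ≟ base (row (g t))
      ...   | no i≢ = ⊥-elim (∞≢elt (trans (sym (cong _^τ (T-off-base (row (g t)) i≢)))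
                        (trans (cong (asSuper T (row (g t))) (sym col≡)) (diagonal (g t)))))
        where
        ∞≢elt : ∀ {c} → ∞ˢ ≢ elt τ c
        ∞≢elt ()
      ...   | yes refl = ⊥-elim (<-irrefl refl (subst₂ Above g≡0 h≡0 (h-above t t)))
        where
        g≡0 : y (g t) +ᴿ z (g t) ≡ 0ℝ
        g≡0 = elt-injective (trans (sym (diagonal (g t)))
          (trans (cong (asSuper T (row (g t))) col≡) (cong _^τ (T-base (row (g t))))))
        h≡0 : asSuper T (row (h t)) (col (g t)) ≡ elt τ 0ℝ
        h≡0 = trans (cong (asSuper T (row (h t))) (trans col≡ (cong inj₁ (sym (base-h t)))))
                    (cong _^τ (T-base (row (h t))))

      at-J : ∀ t {r c} → asSuper T r (col (g t)) ≡ c → asSuper T r (inj₂ (proj₁ (col-J t))) ≡ c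
      at-J t {r} eq = trans (cong (asSuper T r) (sym (proj₂ (col-J t)))) eq
      at-J′ : ∀ t {r c} → Above c (asSuper T r (col (g t))) → Above c (asSuper T r (inj₂ (proj₁ (col-J t))))
      at-J′ t {r} {c} = subst (λ j → Above c (asSuper T r j)) (proj₂ (col-J t))

    -- Comparison of the ranks.

    splitAt-injective : ∀ m {n} → Injective _≡_ _≡_ (splitAt m {n})
    splitAt-injective m {n} {i} {j} eq =
      trans (sym (join-splitAt m n i)) (trans (cong (join m n) eq) (join-splitAt m n j))

    raise-rank : ∀ {k} → HasNonSingSub (Σᵀ p q T) k → HasNonSingSub (asSuper T) (k + p)
    raise-rank {k} ns = dominant⇒nonSingular
      (pullback (splitAt k) (splitAt-injective k) (extend (nonSingular⇒dominant ns)))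

    lower-rank : ∀ {k} → HasNonSingSub (asSuper T) (k + p) → HasNonSingSub (Σᵀ p q T) k
    lower-rank ns = dominant⇒nonSingular (contract (nonSingular⇒dominant ns))

    rank⇔rank : ∀ s → IsTropRank (Σᵀ p q T) s ⇔ IsTropRank (asSuper T) (s + p)
    rank⇔rank s = mk⇔
      (λ (ns , max) → raise-rank ns , λ k ns′ → bound max k ns′)
      (λ (ns , max) → lower-rank ns , λ k ns′ → ℕₚ.+-cancelʳ-≤ p k s (max (k + p) (raise-rank ns′)))
      where
      bound : (∀ k → HasNonSingSub (Σᵀ p q T) k → k ≤ s) → ∀ k → HasNonSingSub (asSuper T) k → k ≤ s + p
      -- Sizes up to `p` satisfy the bound trivially; a larger size has the form `(k ∸ p) + p`, to
      -- which `lower-rank` applies.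
      bound max k ns with ℕₚ.≤-total p k
      ... | inj₂ k≤p = ℕₚ.≤-trans k≤p (ℕₚ.m≤n+m p s)
      ... | inj₁ p≤k = subst (_≤ s + p) (ℕₚ.m∸n+n≡m p≤k) (ℕₚ.+-monoˡ-≤ p (max (k ∸ p)
              (lower-rank (subst (HasNonSingSub (asSuper T)) (sym (ℕₚ.m∸n+n≡m p≤k)) ns))))

theorem4 : (RN : RealNumbers) → let open Tropical RN in
    (p q : ℕ) (T : Fin p ⊎ Fin p → Fin p ⊎ Fin q → ℝ̄) →
    Symmetrized p q T →
    ∀ s → IsTropRank (Σᵀ p q T) s ⇔ IsTropRank (asSuper T) (s + p)
theorem4 RN p q T sym-T s = Supertropical.rank⇔rank RN T sym-T s
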